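{- For every constant $\alpha>\frac{3\sqrt{6}}{8}$ there exists a constant $C$ such that the following holds. Let $G$ be a (simple) graph on $n$ vertices, and let the edges of $G$ be colored with $\alpha n$ colors so that each color class is a matching consisting of exactly $2$ edges. Then the rainbow girth of $G$ is at most $C\log n$; that is, $G$ contains a cycle of length at most $C\log n$ whose edges all have distinct colors.
   Context: An edge coloring need not be proper. A subgraph is rainbow if its edges have pairwise distinct colors; the rainbow girth is the minimum length of a rainbow cycle. Logarithms are base $2$. -}

module Defs where

open import Data.Nat using (ℕ; zero; suc; _+_; _*_; _^_; _≤_; _<_)
open import Data.Nat.DivMod using (_%_; m%n<n)
open import Data.Fin using (Fin; toℕ; fromℕ<) renaming (zero to fzero; suc to fsuc)
open import Data.Product using (_×_; _,_; proj₁; proj₂)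
open import Data.Sum using (_⊎_)
open import Data.Empty using (⊥)
open import Function.Definitions using (Injective)
open import Relation.Binary.PropositionalEquality using (_≡_; _≢_)

Edge : ℕ → Set
Edge n = Fin n × Fin n

_∈ₑ_ : ∀ {n} → Fin n → Edge n → Set
x ∈ₑ e = (x ≡ proj₁ e) ⊎ (x ≡ proj₂ e)

SameEdge : ∀ {n} → Edge n → Edge n → Set
SameEdge (a , b) (c , d) = (a ≡ c × b ≡ d) ⊎ (a ≡ d × b ≡ c)

Disjoint : ∀ {n} → Edge n → Edge n → Set
Disjoint e f = ∀ x → x ∈ₑ e → x ∈ₑ f → ⊥

-- A simple graph on vertex set Fin n whose edges are colored with k colors,
-- every color class being a matching of exactly two edges.
-- Encoding: color c's two edges are edge c 0 and edge c 1; the edge set of G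
-- is exactly {edge c i}, and the color of edge c i is c.
record TwoMatchingColoredGraph (n k : ℕ) : Set where
  field
    edge     : Fin k → Fin 2 → Edge n
    loopless : ∀ c i → proj₁ (edge c i) ≢ proj₂ (edge c i)
    simple   : ∀ c i c′ i′ → SameEdge (edge c i) (edge c′ i′) → (c ≡ c′ × i ≡ i′)
    matching : ∀ c → Disjoint (edge c fzero) (edge c (fsuc fzero))

next : ∀ {m} → Fin (suc m) → Fin (suc m)
next {m} i = fromℕ< (m%n<n (suc (toℕ i)) (suc m))

record RainbowCycle {n k : ℕ} (G : TwoMatchingColoredGraph n k) (m : ℕ) : Set where
  open TwoMatchingColoredGraph G
  field
    long     : 2 ≤ m
    vtx      : Fin (suc m) → Fin n
    vtx-inj  : Injective _≡_ _≡_ vtx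
    col      : Fin (suc m) → Fin k
    slot     : Fin (suc m) → Fin 2
    is-edge  : ∀ i → SameEdge (edge (col i) (slot i)) (vtx i , vtx (next i))
    rainbow  : Injective _≡_ _≡_ col

{-# OPTIONS --safe #-}
module Submission where

-- Keep every vertex independently with probability x.  A colour survives (one
-- of its edges has both ends kept) with probability 2x² - x⁴, so the expected
-- number of surviving colours exceeds (1 + ε) times that of kept vertices as
-- soon as α (2x - x³) > 1 + ε; the maximum of 2x - x³ is 4√6/9 = 1/(3√6/8), at
-- x = √(2/3).  Choosing one kept edge per surviving colour leaves a rainbow
-- graph with more than 1 + ε edges per vertex.
--
-- In such a graph, grow a breadth-first ball.  If the ball U meets at most
-- (1 + ε)|U| edges, delete it: the density hypothesis persists.  Otherwise the
-- edges meeting U close a short cycle with the tree of U, or they all enlarge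
-- this tree, and then the ball has grown by a factor 1 + ε, which can happen
-- only O(log n) times.

open import Defs
open import Data.Nat using (ℕ; zero; suc; _+_; _*_; _^_; _∸_; _≤_; _<_; _≟_; _≤?_; _<?_; s≤s; z≤n; s≤s⁻¹; NonZero; >-nonZero)
open import Data.Nat.Properties hiding (_≟_; _≤?_; _<?_)
open import Data.Nat.DivMod using (_%_; m%n<n; m<n⇒m%n≡m; n%n≡0)
open import Data.Nat.ListAction using (sum; product)
open import Data.Nat.Tactic.RingSolver using (solve-∀)
open import Data.Fin using (Fin; toℕ) renaming (zero to fzero; suc to fsuc)
import Data.Fin as Fin
open import Data.Fin.Properties using (toℕ-fromℕ<; toℕ<n; toℕ-injective; injective⇒≤)
open import Data.List using (List; []; _∷_; length; lookup; filter; map; allFin)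
open import Data.List.Properties using (length-tabulate)
open import Data.List.Relation.Unary.Any using (here; there; index)
open import Data.List.Relation.Unary.Any.Properties using (lookup-index)
open import Data.List.Relation.Unary.All using ([]; _∷_)
open import Data.List.Relation.Unary.All.Properties using (¬Any⇒All¬)
open import Data.List.Relation.Unary.AllPairs using ([]; _∷_)
open import Data.List.Relation.Unary.Unique.Propositional using (Unique)
open import Data.List.Relation.Unary.Unique.Propositional.Properties using (filter⁺; allFin⁺; Unique[x∷xs]⇒x∉xs)
open import Data.List.Relation.Binary.Disjoint.Propositional using () renaming (Disjoint to Apart)
open import Data.List.Relation.Binary.Subset.Propositional using (_⊆_)
open import Data.List.Membership.Propositional using (_∈_; _∉_)
open import Data.List.Membership.Propositional.Properties using (∈-lookup; ∈-filter⁺; ∈-filter⁻; ∈-allFin)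
import Data.List.Membership.DecPropositional as DecMembership
open import Data.Product using (Σ; _×_; _,_; proj₁; proj₂)
open import Data.Sum using (_⊎_; inj₁; inj₂; [_,_]′)
import Data.Sum as Sum
open import Data.Vec.Functional using (updateAt)
open import Data.Vec.Functional.Properties using (updateAt-updates; updateAt-minimal)
open import Function using (_∘_; const)
open import Function.Definitions using (Injective)
open import Relation.Nullary using (¬_; Dec; yes; no; ¬?; contradiction; _⊎-dec_; _×-dec_)
open import Relation.Unary using (Decidable)
open import Relation.Binary.PropositionalEquality using (_≡_; refl; sym; trans; cong; cong₂; subst)

-- Duplicate-free lists and the cyclic successor.

unique-∷ : ∀ {A : Set} {x : A} {xs} → x ∉ xs → Unique xs → Unique (x ∷ xs)
unique-∷ x∉xs u = ¬Any⇒All¬ _ x∉xs ∷ u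

lookup-injective : ∀ {A : Set} {xs : List A} → Unique xs → Injective _≡_ _≡_ (lookup xs)
lookup-injective {xs = _ ∷ _}  _          {fzero}  {fzero}  _  = refl
lookup-injective {xs = _ ∷ xs} u          {fzero}  {fsuc j} eq =
  contradiction (subst (_∈ xs) (sym eq) (∈-lookup j)) (Unique[x∷xs]⇒x∉xs u)
lookup-injective {xs = _ ∷ xs} u          {fsuc i} {fzero}  eq =
  contradiction (subst (_∈ xs) eq (∈-lookup i)) (Unique[x∷xs]⇒x∉xs u)
lookup-injective {xs = _ ∷ _}  (_ ∷ u)    {fsuc i} {fsuc j} eq = cong fsuc (lookup-injective u eq)

length-mono-⊆ : ∀ {A : Set} {xs ys : List A} → Unique xs → xs ⊆ ys → length xs ≤ length ys
length-mono-⊆ {xs = xs} {ys} u xs⊆ys = injective⇒≤ {f = position} position-injective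
  where
  position : Fin (length xs) → Fin (length ys)
  position i = index (xs⊆ys (∈-lookup i))
  position-injective : Injective _≡_ _≡_ position
  position-injective {i} {j} eq = lookup-injective u (trans (lookup-index (xs⊆ys (∈-lookup i)))
    (trans (cong (lookup ys) eq) (sym (lookup-index (xs⊆ys (∈-lookup j))))))

length-filter-split : ∀ {A : Set} {P : A → Set} (P? : Decidable P) (xs : List A) →
  length xs ≡ length (filter P? xs) + length (filter (¬? ∘ P?) xs)
length-filter-split P? [] = refl
length-filter-split P? (x ∷ xs) with P? x
... | yes _ = cong suc (length-filter-split P? xs)
... | no  _ = trans (cong suc (length-filter-split P? xs)) (sym (+-suc _ _))

unique-length≤ : ∀ {n} {xs : List (Fin n)} → Unique xs → length xs ≤ n
unique-length≤ u = injective⇒≤ (lookup-injective u)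

toℕ-next : ∀ {m} (i : Fin (suc m)) → (toℕ i ≡ m × next i ≡ fzero) ⊎ (toℕ (next i) ≡ suc (toℕ i))
toℕ-next {m} i with m≤n⇒m<n∨m≡n (s≤s⁻¹ (toℕ<n i))
... | inj₁ i<m = inj₂ (trans (toℕ-fromℕ< (m%n<n (suc (toℕ i)) (suc m))) (m<n⇒m%n≡m (s≤s i<m)))
... | inj₂ i≡m = inj₁ (i≡m , toℕ-injective
      (trans (toℕ-fromℕ< (m%n<n (suc (toℕ i)) (suc m)))
             (trans (cong (λ x → suc x % suc m) i≡m) (n%n≡0 (suc m)))))

-- Rainbow cycles from closed arcs.

module Growth {n k : ℕ} (G : TwoMatchingColoredGraph n k) (slot : Fin k → Fin 2) where
  open TwoMatchingColoredGraph G
  open DecMembership (Fin._≟_ {n}) using () renaming (_∈?_ to _∈ᵛ?_)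
  open DecMembership (Fin._≟_ {k}) using () renaming (_∈?_ to _∈ᶜ?_)

  -- With one edge fixed per colour, a colour stands for its edge, and a subgraph is rainbow as soon
  -- as its colours are listed without repetition.
  ends : Fin k → Edge n
  ends c = edge c (slot c)

  Joins : Fin k → Fin n → Fin n → Set
  Joins c u v = SameEdge (ends c) (u , v)

  joins-sym : ∀ {c u v} → Joins c u v → Joins c v u
  joins-sym (inj₁ (p , q)) = inj₂ (p , q)
  joins-sym (inj₂ (p , q)) = inj₁ (p , q)

  joins-irrefl : ∀ {c u} → ¬ Joins c u u
  joins-irrefl {c} (inj₁ (p , q)) = loopless c (slot c) (trans p (sym q))
  joins-irrefl {c} (inj₂ (p , q)) = loopless c (slot c) (trans p (sym q))

  joins-unique : ∀ {c d u v} → Joins c u v → Joins d u v → c ≡ d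
  joins-unique {c} {d} jc jd = proj₁ (simple c (slot c) d (slot d) (same jc jd))
    where
    same : ∀ {a b u v} → SameEdge a (u , v) → SameEdge b (u , v) → SameEdge a b
    same (inj₁ (refl , refl)) (inj₁ (refl , refl)) = inj₁ (refl , refl)
    same (inj₁ (refl , refl)) (inj₂ (refl , refl)) = inj₂ (refl , refl)
    same (inj₂ (refl , refl)) (inj₁ (refl , refl)) = inj₂ (refl , refl)
    same (inj₂ (refl , refl)) (inj₂ (refl , refl)) = inj₁ (refl , refl)

  -- A walk from u to z in which xs lists the vertices strictly between u and
  -- z; leaving z out makes the closed walks with Unique (u ∷ xs) exactly the
  -- vertex-simple ones.
  data Arc (z : Fin n) : Fin n → List (Fin n) → List (Fin k) → Set where
    last : ∀ {u c} → Joins c u z → Arc z u [] (c ∷ [])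
    step : ∀ {u v c xs cs} → Joins c u v → Arc z v xs cs → Arc z u (v ∷ xs) (c ∷ cs)

  colAt : ∀ {z u xs cs} → Arc z u xs cs → Fin (suc (length xs)) → Fin k
  colAt (last {c = c} _)   _        = c
  colAt (step {c = c} _ _) fzero    = c
  colAt (step _ A)         (fsuc i) = colAt A i

  -- Needed apart from `lookup` because `z` is absent from `xs`: only on a closed arc is the vertex
  -- entered by edge `i` the entry of `z ∷ xs` at `next i`.
  after : ∀ {z u xs cs} → Arc z u xs cs → Fin (suc (length xs)) → Fin n
  after {z} (last _)       _        = z
  after (step {v = v} _ _) fzero    = v
  after (step _ A)         (fsuc i) = after A i

  colAt-∈ : ∀ {z u xs cs} (A : Arc z u xs cs) i → colAt A i ∈ cs
  colAt-∈ (last _)   _        = here refl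
  colAt-∈ (step _ _) fzero    = here refl
  colAt-∈ (step _ A) (fsuc i) = there (colAt-∈ A i)

  colAt-injective : ∀ {z u xs cs} (A : Arc z u xs cs) → Unique cs → Injective _≡_ _≡_ (colAt A)
  colAt-injective (last _)   _       {fzero}  {fzero}  _  = refl
  colAt-injective (step _ _) _       {fzero}  {fzero}  _  = refl
  colAt-injective (step {cs = cs} _ A) u {fzero} {fsuc j} eq =
    contradiction (subst (_∈ cs) (sym eq) (colAt-∈ A j)) (Unique[x∷xs]⇒x∉xs u)
  colAt-injective (step {cs = cs} _ A) u {fsuc i} {fzero} eq =
    contradiction (subst (_∈ cs) eq (colAt-∈ A i)) (Unique[x∷xs]⇒x∉xs u)
  colAt-injective (step _ A) (_ ∷ u) {fsuc i} {fsuc j} eq = cong fsuc (colAt-injective A u eq)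

  colAt-joins : ∀ {z u xs cs} (A : Arc z u xs cs) i → Joins (colAt A i) (lookup (u ∷ xs) i) (after A i)
  colAt-joins (last j)   fzero    = j
  colAt-joins (step j _) fzero    = j
  colAt-joins (step _ A) (fsuc i) = colAt-joins A i

  after-last : ∀ {z u xs cs} (A : Arc z u xs cs) i → toℕ i ≡ length xs → after A i ≡ z
  after-last (last _)   _        _  = refl
  after-last (step _ A) (fsuc i) eq = after-last A i (suc-injective eq)

  after-suc : ∀ {z u xs cs} (A : Arc z u xs cs) i j → toℕ j ≡ suc (toℕ i) → after A i ≡ lookup (u ∷ xs) j
  after-suc (last _)   fzero    (fsuc ())       _
  after-suc (step _ _) fzero    (fsuc fzero)    _  = refl
  after-suc (step _ _) fzero    (fsuc (fsuc _)) ()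
  after-suc (step _ A) (fsuc i) (fsuc j)        eq = after-suc A i j (suc-injective eq)

  after-next : ∀ {z xs cs} (A : Arc z z xs cs) i → after A i ≡ lookup (z ∷ xs) (next i)
  after-next {z} {xs} A i with toℕ-next i
  ... | inj₁ (eq , next≡0) = trans (after-last A i eq) (sym (cong (lookup (z ∷ xs)) next≡0))
  ... | inj₂ eq            = after-suc A i (next i) eq

  -- With no interior vertex the edge would be a loop; with one, both edges would join the same two
  -- vertices and so, the graph being simple, share their colour.
  closed-long : ∀ {z xs cs} → Arc z z xs cs → Unique cs → 2 ≤ length xs
  closed-long (last j)                  _ = contradiction j joins-irrefl
  closed-long (step i (last j))         u =
    contradiction (here (joins-unique i (joins-sym j))) (Unique[x∷xs]⇒x∉xs u)
  closed-long (step _ (step _ (last _)))     _ = s≤s (s≤s z≤n)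
  closed-long (step _ (step _ (step _ _)))   _ = s≤s (s≤s z≤n)

  arc⇒cycle : ∀ {z xs cs} → Arc z z xs cs → Unique (z ∷ xs) → Unique cs → RainbowCycle G (length xs)
  arc⇒cycle {z} {xs} A uv uc = record
    { long    = closed-long A uc
    ; vtx     = lookup (z ∷ xs)
    ; vtx-inj = lookup-injective uv
    ; col     = colAt A
    ; slot    = slot ∘ colAt A
    ; is-edge = λ i → subst (Joins (colAt A i) (lookup (z ∷ xs) i)) (after-next A i) (colAt-joins A i)
    ; rainbow = colAt-injective A uc
    }

  -- Rainbow trees and their fundamental cycles.

  data Tree (r : Fin n) : List (Fin n) → List (Fin k) → Set where
    root : Tree r (r ∷ []) []
    grow : ∀ {u v c vs es} → Tree r vs es → u ∈ vs → v ∉ vs → c ∉ es → Joins c v u →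
           Tree r (v ∷ vs) (c ∷ es)

  -- The membership proof locates the step that attached `x`, so the recursion can follow the tree
  -- towards the root.
  depth : ∀ {r vs es x} → Tree r vs es → x ∈ vs → ℕ
  depth root               _         = 0
  depth (grow T u∈ _ _ _)  (here _)  = suc (depth T u∈)
  depth (grow T _ _ _ _)   (there m) = depth T m

  tree-size : ∀ {r vs es} → Tree r vs es → length vs ≡ suc (length es)
  tree-size root             = refl
  tree-size (grow T _ _ _ _) = cong suc (tree-size T)

  tree-unique : ∀ {r vs es} → Tree r vs es → Unique vs
  tree-unique root              = [] ∷ []
  tree-unique (grow T _ v∉ _ _) = unique-∷ v∉ (tree-unique T)

  tree-root : ∀ {r vs es} → Tree r vs es → r ∈ vs
  tree-root root             = here refl
  tree-root (grow T _ _ _ _) = there (tree-root T)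

  -- Here `vs` and `es` belong to the tree, `ys` and `ds` to the arc being prolonged. The fields
  -- `insideᵛ` and `insideᶜ` are what show that the next vertex and colour to be consed are new.
  record SimpleArc (z u : Fin n) (vs ys : List (Fin n)) (es ds : List (Fin k)) (b : ℕ) : Set where
    constructor simpleArc
    field
      {xs}    : List (Fin n)
      {cs}    : List (Fin k)
      arc     : Arc z u xs cs
      uniqueᵛ : Unique (u ∷ xs)
      uniqueᶜ : Unique cs
      short   : length xs ≤ b
      insideᵛ : ∀ {x} → x ∈ u ∷ xs → x ∈ vs ⊎ x ∈ ys
      insideᶜ : ∀ {c} → c ∈ cs → c ∈ es ⊎ c ∈ ds

  -- The tree path from u to w prolongs an arc that starts at w and otherwise
  -- avoids the tree.  Carrying that arc along lets both ends of the path move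
  -- towards the root by consing only.
  prolong : ∀ {r vs es z u w ys ds} (T : Tree r vs es) (u∈ : u ∈ vs) (w∈ : w ∈ vs) → Arc z w ys ds →
            Unique ys → Unique ds → Apart ys vs → Apart ds es →
            SimpleArc z u vs ys es ds (depth T u∈ + depth T w∈ + length ys)
  prolong root (here refl) (here refl) A uy ud ya da =
    simpleArc A (unique-∷ (λ y → ya (y , here refl)) uy) ud ≤-refl
      (λ { (here eq) → inj₁ (here eq) ; (there y) → inj₂ y }) inj₂
  prolong (grow T _ _ _ _) (here refl) (here refl) A uy ud ya da =
    simpleArc A (unique-∷ (λ y → ya (y , here refl)) uy) ud (m≤n+m _ _)
      (λ { (here eq) → inj₁ (here eq) ; (there y) → inj₂ y }) inj₂
  prolong (grow T p∈ v∉ c∉ j) (here refl) (there w∈) A uy ud ya da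
    with simpleArc B uv uc s iv ic ← prolong T p∈ w∈ A uy ud (λ (y , m) → ya (y , there m)) (λ (d , m) → da (d , there m)) =
    simpleArc (step j B)
      (unique-∷ ([ v∉ , (λ y → ya (y , here refl)) ]′ ∘ iv) uv)
      (unique-∷ ([ c∉ , (λ d → da (d , here refl)) ]′ ∘ ic) uc)
      (s≤s s)
      (λ { (here eq) → inj₁ (here eq) ; (there m) → Sum.map₁ there (iv m) })
      (λ { (here eq) → inj₁ (here eq) ; (there m) → Sum.map₁ there (ic m) })
  prolong {ys = ys} (grow T p∈ v∉ c∉ j) (there u∈) (here refl) A uy ud ya da
    with simpleArc B uv uc s iv ic ← prolong T u∈ p∈ (step (joins-sym j) A)
           (unique-∷ (λ y → ya (y , here refl)) uy)
           (unique-∷ (λ d → da (d , here refl)) ud)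
           (λ { (here refl , m) → v∉ m ; (there y , m) → ya (y , there m) })
           (λ { (here refl , m) → c∉ m ; (there d , m) → da (d , there m) }) =
    simpleArc B uv uc (≤-trans s (≤-reflexive (shift (depth T u∈) (depth T p∈) (length ys))))
      (reassign ∘ iv) (reassign ∘ ic)
    where
    reassign : ∀ {A : Set} {x y : A} {as bs} → x ∈ as ⊎ x ∈ y ∷ bs → x ∈ y ∷ as ⊎ x ∈ bs
    reassign (inj₁ m)          = inj₁ (there m)
    reassign (inj₂ (here eq))  = inj₁ (here eq)
    reassign (inj₂ (there m))  = inj₂ m
    shift : ∀ a b c → a + b + suc c ≡ a + suc b + c
    shift a b c = trans (+-suc (a + b) c) (sym (cong (_+ c) (+-suc a b)))
  prolong (grow T _ _ _ _) (there u∈) (there w∈) A uy ud ya da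
    with simpleArc B uv uc s iv ic ← prolong T u∈ w∈ A uy ud (λ (y , m) → ya (y , there m)) (λ (d , m) → da (d , there m)) =
    simpleArc B uv uc s (Sum.map₁ there ∘ iv) (Sum.map₁ there ∘ ic)

  ShortCycle : ℕ → Set
  ShortCycle b = Σ ℕ λ m → m ≤ b × RainbowCycle G m

  -- The tree path from `u` to `v` is closed by the edge of the new colour `c`. A `RainbowCycle` of
  -- index `m` has `m + 1` edges, so the closing edge does not enter the bound.
  fundamentalCycle : ∀ {r vs es u v c} (T : Tree r vs es) (u∈ : u ∈ vs) (v∈ : v ∈ vs) →
                     c ∉ es → Joins c v u → ShortCycle (depth T u∈ + depth T v∈)
  fundamentalCycle T u∈ v∈ c∉ j
    with simpleArc A uv uc s _ _ ← prolong T u∈ v∈ (last j) [] ([] ∷ []) (λ { (() , _) })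
           (λ { (here refl , m) → c∉ m }) =
    _ , ≤-trans s (≤-reflexive (+-identityʳ _)) , arc⇒cycle A uv uc

  -- One round of breadth-first growth.

  Inside : List (Fin n) → Fin k → Set
  Inside ws c = proj₁ (ends c) ∈ ws × proj₂ (ends c) ∈ ws

  Touches : List (Fin n) → Fin k → Set
  Touches vs c = proj₁ (ends c) ∈ vs ⊎ proj₂ (ends c) ∈ vs

  touches? : ∀ vs → Decidable (Touches vs)
  touches? vs c = (proj₁ (ends c) ∈ᵛ? vs) ⊎-dec (proj₂ (ends c) ∈ᵛ? vs)

  -- A round in progress: `us` is the ball at its start, `fs` the edges already treated. By `core`
  -- the old vertices stay at depth at most `t`, so leaves hung from them have depth at most
  -- `t + 1`.
  record Enlarged (r : Fin n) (t : ℕ) (us ws : List (Fin n)) (fs : List (Fin k)) : Set where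
    constructor enlarged
    field
      {vs}    : List (Fin n)
      {es}    : List (Fin k)
      tree    : Tree r vs es
      bounded : ∀ {x} (m : x ∈ vs) → depth tree m ≤ suc t
      core    : ∀ {x} → x ∈ us → Σ (x ∈ vs) λ m → depth tree m ≤ t
      inside  : vs ⊆ ws
      covered : fs ⊆ es

  -- If the far end `v` is already in the tree, its depth is at most `t + 1` and the fundamental
  -- cycle is short; otherwise `v` becomes a leaf below `u`.
  attach : ∀ {r t us ws fs} c {u v} → Enlarged r t us ws fs → Joins c v u → u ∈ us → v ∈ ws →
           ShortCycle (t + suc t) ⊎ Enlarged r t us ws (c ∷ fs)
  attach {t = t} c {u} {v} (enlarged {vs} {es} T bd co ins cov) j u∈us v∈ws with c ∈ᶜ? es
  ... | yes c∈ = inj₂ (enlarged T bd co ins (λ { (here refl) → c∈ ; (there m) → cov m }))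
  ... | no  c∉ with co u∈us | v ∈ᵛ? vs
  ...   | u∈ , du≤ | yes v∈ with m , m≤ , C ← fundamentalCycle T u∈ v∈ c∉ j =
            inj₁ (m , ≤-trans m≤ (+-mono-≤ du≤ (bd v∈)) , C)
  ...   | u∈ , du≤ | no  v∉ = inj₂ (enlarged (grow T u∈ v∉ c∉ j)
            (λ { (here _) → s≤s du≤ ; (there m) → bd m })
            (λ m → there (proj₁ (co m)) , proj₂ (co m))
            (λ { (here refl) → v∈ws ; (there m) → ins m })
            (λ { (here refl) → here refl ; (there m) → there (cov m) }))

  attachAll : ∀ {r t us ws es} (T : Tree r us es) → (∀ {x} (m : x ∈ us) → depth T m ≤ t) → us ⊆ ws →
              ∀ fs → (∀ {c} → c ∈ fs → Inside ws c × Touches us c) →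
              ShortCycle (t + suc t) ⊎ Enlarged r t us ws fs
  attachAll T bd ins [] _ =
    inj₂ (enlarged T (λ m → m≤n⇒m≤1+n (bd m)) (λ m → m , bd m) ins (λ ()))
  attachAll T bd ins (c ∷ fs) ok with attachAll T bd ins fs (ok ∘ there)
  ... | inj₁ C = inj₁ C
  ... | inj₂ E with ok (here refl)
  ...   | (_ , q∈) , inj₁ p∈us = attach c E (inj₂ (refl , refl)) p∈us q∈
  ...   | (p∈ , _) , inj₂ q∈us = attach c E (inj₁ (refl , refl)) q∈us p∈

  -- Short cycles in graphs with more than `P / Q` edges per vertex.

  module _ (Q P R : ℕ) (big : Q ^ R * n < P ^ R) where

    -- A set that may be deleted, at a cost of at most `P / Q` edges per vertex; `centre` ensures
    -- that the deletion makes progress.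
    record Sparse (ws : List (Fin n)) (hs : List (Fin k)) : Set where
      constructor sparse
      field
        {vs}     : List (Fin n)
        {centre} : Fin n
        unique   : Unique vs
        centre∈  : centre ∈ vs
        inside   : vs ⊆ ws
        few      : Q * length (filter (touches? vs) hs) ≤ P * length vs

    -- Here `t` counts the rounds done and `j` those left. The last hypothesis says that the ball
    -- has at least (P/Q)^t vertices; a round preserves it because every edge touching the ball ends
    -- up in the new tree.
    expand : ∀ {r us es} ws hs → Unique hs → (∀ {c} → c ∈ hs → Inside ws c) →
             ∀ j t → j + t ≡ R → (T : Tree r us es) → (∀ {x} (m : x ∈ us) → depth T m ≤ t) → us ⊆ ws →
             P ^ t ≤ Q ^ t * length us →
             ShortCycle (R + R) ⊎ Sparse ws hs
    -- After `R` rounds the ball would have more than `n` vertices, by `big`.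
    expand ws hs uh ih zero t refl T bd ins size =
      contradiction (≤-trans size (*-monoʳ-≤ (Q ^ t) (unique-length≤ (tree-unique T)))) (<⇒≱ big)
    expand {us = us} ws hs uh ih (suc j) t eq T bd ins size
      with Q * length (filter (touches? us) hs) ≤? P * length us
    ... | yes few = inj₂ (sparse (tree-unique T) (tree-root T) ins few)
    ... | no many with attachAll T bd ins (filter (touches? us) hs)
                         (λ m → ih (proj₁ (∈-filter⁻ (touches? us) m)) , proj₂ (∈-filter⁻ (touches? us) {xs = hs} m))
    ...   | inj₁ (m , m≤ , C) = inj₁ (m , ≤-trans m≤ (+-mono-≤ (≤-trans (n≤1+n t) t<R) t<R) , C)
      where
      t<R : suc t ≤ R
      t<R = ≤-trans (m≤n+m (suc t) j) (≤-reflexive (trans (+-suc j t) eq))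
    ...   | inj₂ (enlarged {vs} {es} T′ bd′ _ ins′ cov) =
      expand ws hs uh ih j (suc t) (trans (+-suc j t) eq) T′ bd′ ins′ size′
      where
      open ≤-Reasoning
      F = filter (touches? us) hs
      -- The touched edges all lie in the tree, which has one vertex more than it has edges.
      F≤ : length F ≤ length vs
      F≤ = ≤-trans (length-mono-⊆ (filter⁺ (touches? us) uh) cov)
             (≤-trans (n≤1+n _) (≤-reflexive (sym (tree-size T′))))
      size′ : P * P ^ t ≤ Q * Q ^ t * length vs
      size′ = begin
        P * P ^ t                   ≤⟨ *-monoʳ-≤ P size ⟩
        P * (Q ^ t * length us)     ≡⟨ trans (sym (*-assoc P _ _)) (trans (cong (_* length us) (*-comm P (Q ^ t))) (*-assoc (Q ^ t) P _)) ⟩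
        Q ^ t * (P * length us)     ≤⟨ *-monoʳ-≤ (Q ^ t) (<⇒≤ (≰⇒> many)) ⟩
        Q ^ t * (Q * length F)      ≤⟨ *-monoʳ-≤ (Q ^ t) (*-monoʳ-≤ Q F≤) ⟩
        Q ^ t * (Q * length vs)     ≡⟨ trans (sym (*-assoc (Q ^ t) _ _)) (cong (_* length vs) (*-comm (Q ^ t) Q)) ⟩
        Q * Q ^ t * length vs       ∎

    -- Deleting a sparse set loses at most `P / Q` edges per deleted vertex, so the strict density
    -- bound passes to the rest. Since the set is nonempty, the bound `N` on the vertices drops, and
    -- the process can only stop at a cycle.
    shortCycle : ∀ N ws hs → length ws ≤ N → Unique hs → (∀ {c} → c ∈ hs → Inside ws c) →
                 P * length ws < Q * length hs → ShortCycle (R + R)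
    shortCycle N ws [] _ _ _ dense =
      contradiction (≤-trans dense (≤-reflexive (*-zeroʳ Q))) λ ()
    shortCycle zero [] (c ∷ hs) _ _ ih dense = contradiction (proj₁ (ih (here refl))) λ ()
    -- An end of the first edge of `hs` serves as root.
    shortCycle (suc N) ws hs@(c ∷ _) ws≤ uh ih dense
      with expand ws hs uh ih R 0 (+-identityʳ R) root (λ _ → z≤n)
             (λ { (here refl) → proj₁ (ih (here refl)) }) (≤-refl {1})
    ... | inj₁ C = C
    ... | inj₂ (sparse {vs} uvs r∈ ins few) =
      shortCycle N ws′ hs′ ws′≤ (filter⁺ (¬? ∘ touches? vs) uh) ih′ dense′
      where
      open ≤-Reasoning
      ws′ = filter (¬? ∘ (_∈ᵛ? vs)) ws
      hs′ = filter (¬? ∘ touches? vs) hs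
      vs≤ : length vs + length ws′ ≤ length ws
      vs≤ = ≤-trans (+-monoˡ-≤ _ (length-mono-⊆ uvs (λ m → ∈-filter⁺ (_∈ᵛ? vs) (ins m) m)))
              (≤-reflexive (sym (length-filter-split (_∈ᵛ? vs) ws)))
      nonempty : ∀ {x : Fin n} {xs} → x ∈ xs → 1 ≤ length xs
      nonempty (here _)  = s≤s z≤n
      nonempty (there _) = s≤s z≤n
      ws′≤ : length ws′ ≤ N
      ws′≤ = s≤s⁻¹ (≤-trans (≤-trans (+-monoˡ-≤ _ (nonempty r∈)) vs≤) ws≤)
      ih′ : ∀ {d} → d ∈ hs′ → Inside ws′ d
      ih′ d∈ with d∈hs , ¬touch ← ∈-filter⁻ (¬? ∘ touches? vs) {xs = hs} d∈ =
        ∈-filter⁺ _ (proj₁ (ih d∈hs)) (¬touch ∘ inj₁) , ∈-filter⁺ _ (proj₂ (ih d∈hs)) (¬touch ∘ inj₂)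
      F = filter (touches? vs) hs
      dense′ : P * length ws′ < Q * length hs′
      dense′ = +-cancelˡ-< (P * length vs) _ _ (begin-strict
        P * length vs + P * length ws′ ≡⟨ *-distribˡ-+ P _ _ ⟨
        P * (length vs + length ws′)   ≤⟨ *-monoʳ-≤ P vs≤ ⟩
        P * length ws                  <⟨ dense ⟩
        Q * length hs                  ≡⟨ cong (Q *_) (length-filter-split (touches? vs) hs) ⟩
        Q * (length F + length hs′)    ≡⟨ *-distribˡ-+ Q _ _ ⟩
        Q * length F + Q * length hs′  ≤⟨ +-monoˡ-≤ _ few ⟩
        P * length vs + Q * length hs′ ∎)

-- Sums over lists.

sum-map-*ˡ : ∀ {A : Set} b (f : A → ℕ) xs → b * sum (map f xs) ≡ sum (map (λ x → b * f x) xs)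
sum-map-*ˡ b f [] = *-zeroʳ b
sum-map-*ˡ b f (x ∷ xs) = trans (*-distribˡ-+ b _ _) (cong (b * f x +_) (sum-map-*ˡ b f xs))

sum-map-const : ∀ {A : Set} {f : A → ℕ} {e} → (∀ x → f x ≡ e) → ∀ xs → sum (map f xs) ≡ length xs * e
sum-map-const f≡ []       = refl
sum-map-const f≡ (x ∷ xs) = cong₂ _+_ (f≡ x) (sum-map-const f≡ xs)

sum-map-≤-filter : ∀ {A : Set} {P : A → Set} (P? : Decidable P) {f g : A → ℕ} {e} →
  (∀ x → P x → f x ≤ g x + e) → (∀ x → ¬ P x → f x ≤ g x) →
  ∀ xs → sum (map f xs) ≤ sum (map g xs) + length (filter P? xs) * e
sum-map-≤-filter P? p q [] = z≤n
sum-map-≤-filter P? {f} {g} {e} p q (x ∷ xs) with P? x | sum-map-≤-filter P? p q xs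
... | yes px | ih = ≤-trans (+-mono-≤ (p x px) ih)
  (≤-reflexive (regroup (g x) e (sum (map g xs)) _))
  where
  regroup : ∀ a b c d → a + b + (c + d) ≡ a + c + (b + d)
  regroup = solve-∀
... | no ¬px | ih = ≤-trans (+-mono-≤ (q x ¬px) ih) (≤-reflexive (sym (+-assoc (g x) _ _)))

-- Derandomisation by conditional expectations.

module Rounding {n : ℕ} (a d : ℕ) .{{_ : NonZero (d + a)}} where
  b : ℕ
  b = d + a

  -- The ratio of `x v` to `b` is the probability of keeping `v`: the values `0` and `b` are
  -- decided, `a` is undecided.
  Point : Set
  Point = Fin n → ℕ

  -- F is affine in each single coordinate, read at the point a = (d · 0 + a · b) / b.
  Affine : (Point → ℕ) → Set
  Affine F = ∀ x v → x v ≡ a →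
    b * F x ≡ d * F (updateAt x v (const 0)) + a * F (updateAt x v (const b))

  affine-+ : ∀ {F H} → Affine F → Affine H → Affine (λ x → F x + H x)
  affine-+ {F} {H} aF aH x v xv = trans (*-distribˡ-+ b (F x) (H x))
    (trans (cong₂ _+_ (aF x v xv) (aH x v xv)) (regroup d a _ _ _ _))
    where
    regroup : ∀ d a p q r s → d * p + a * q + (d * r + a * s) ≡ d * (p + r) + a * (q + s)
    regroup = solve-∀

  affine-* : ∀ e {F} → Affine F → Affine (λ x → e * F x)
  affine-* e {F} aF x v xv = trans (swap b e (F x)) (trans (cong (e *_) (aF x v xv)) (regroup d a e _ _))
    where
    swap : ∀ b e f → b * (e * f) ≡ e * (b * f)
    swap = solve-∀
    regroup : ∀ d a e p q → e * (d * p + a * q) ≡ d * (e * p) + a * (e * q)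
    regroup = solve-∀

  affine-sum : ∀ {A : Set} (F : A → Point → ℕ) → (∀ c → Affine (F c)) → ∀ cs →
               Affine (λ x → sum (map (λ c → F c x) cs))
  affine-sum F aF []       x v xv = zeros b d a
    where
    zeros : ∀ b d a → b * 0 ≡ d * 0 + a * 0
    zeros = solve-∀
  affine-sum F aF (c ∷ cs) = affine-+ {F c} (aF c) (affine-sum F aF cs)

  monomial : List (Fin n) → Point → ℕ
  monomial us x = product (map x us)

  monomial-local : ∀ {v} us x f → v ∉ us → monomial us (updateAt x v f) ≡ monomial us x
  monomial-local []       x f v∉ = refl
  monomial-local {v} (u ∷ us) x f v∉ = cong₂ _*_
    (updateAt-minimal u v x (λ u≡v → v∉ (here (sym u≡v))))
    (monomial-local us x f (v∉ ∘ there))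

  -- A product of distinct variables has degree at most one in each of them.
  affine-monomial : ∀ {us} → Unique us → Affine (monomial us)
  affine-monomial {[]}     _ x v xv = *-distribʳ-+ 1 d a
  affine-monomial {u ∷ us} uu@(_ ∷ u′) x v xv with v Fin.≟ u
  ... | yes refl
    rewrite xv | updateAt-updates u {const 0} x | updateAt-updates u {const b} x
          | monomial-local us x (const b) (Unique[x∷xs]⇒x∉xs uu) = regroup d a (monomial us x)
    where
    regroup : ∀ d a m → (d + a) * (a * m) ≡ d * 0 + a * ((d + a) * m)
    regroup = solve-∀
  ... | no v≢u
    rewrite updateAt-minimal u v {const 0} x (v≢u ∘ sym) | updateAt-minimal u v {const b} x (v≢u ∘ sym) =
      trans (swap b (x u) _) (trans (cong (x u *_) (affine-monomial u′ x v xv)) (regroup d a (x u) _ _))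
    where
    swap : ∀ b e f → b * (e * f) ≡ e * (b * f)
    swap = solve-∀
    regroup : ∀ d a e p q → e * (d * p + a * q) ≡ d * (e * p) + a * (e * q)
    regroup = solve-∀

  Rounded : Point → Set
  Rounded x = ∀ v → x v ≡ 0 ⊎ x v ≡ b

  -- The undecided coordinates are settled one by one, each time with an outcome that preserves
  -- `F < H`.
  round : ∀ {F H} → Affine F → Affine H → ∀ vs x →
          (∀ v → (x v ≡ 0 ⊎ x v ≡ b) ⊎ (x v ≡ a × v ∈ vs)) → F x < H x →
          Σ Point λ y → Rounded y × F y < H y
  round aF aH [] x st lt = x , (λ v → [ (λ r → r) , (λ { (_ , ()) }) ]′ (st v)) , lt
  round {F} {H} aF aH (v ∷ vs) x st lt with st v
  ... | inj₁ r = round aF aH vs x st′ lt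
    where
    st′ : ∀ u → (x u ≡ 0 ⊎ x u ≡ b) ⊎ (x u ≡ a × u ∈ vs)
    st′ u with st u
    ... | inj₁ s                = inj₁ s
    ... | inj₂ (_ , here refl)  = inj₁ r
    ... | inj₂ (eq , there u∈)  = inj₂ (eq , u∈)
  ... | inj₂ (xv , _) = choose (F x₀ <? H x₀) (F x₁ <? H x₁)
    where
    x₀ x₁ : Point
    x₀ = updateAt x v (const 0)
    x₁ = updateAt x v (const b)
    status : ∀ e → (e ≡ 0 ⊎ e ≡ b) → ∀ u →
             (updateAt x v (const e) u ≡ 0 ⊎ updateAt x v (const e) u ≡ b) ⊎ (updateAt x v (const e) u ≡ a × u ∈ vs)
    status e r u with u Fin.≟ v
    ... | yes refl rewrite updateAt-updates u {const e} x = inj₁ r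
    ... | no u≢v rewrite updateAt-minimal u v {const e} x u≢v with st u
    ...   | inj₁ s                = inj₁ s
    ...   | inj₂ (_ , here u≡v)   = contradiction u≡v u≢v
    ...   | inj₂ (eq , there u∈)  = inj₂ (eq , u∈)
    choose : Dec (F x₀ < H x₀) → Dec (F x₁ < H x₁) → Σ Point λ y → Rounded y × F y < H y
    choose (yes p) _       = round aF aH vs x₀ (status 0 (inj₁ refl)) p
    choose (no _)  (yes p) = round aF aH vs x₁ (status b (inj₂ refl)) p
    -- If `H ≤ F` held for both outcomes, it would hold for their average with weights `d` and `a`,
    -- which is the situation at `x`.
    choose (no p)  (no q)  = contradiction lt (≤⇒≯ (*-cancelˡ-≤ b (begin
      b * H x             ≡⟨ aH x v xv ⟩
      d * H x₀ + a * H x₁ ≤⟨ +-mono-≤ (*-monoʳ-≤ d (≮⇒≥ p)) (*-monoʳ-≤ a (≮⇒≥ q)) ⟩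
      d * F x₀ + a * F x₁ ≡⟨ aF x v xv ⟨
      b * F x             ∎)))
      where
      open ≤-Reasoning

length-filter-≤-sum : ∀ {A : Set} {P : A → Set} (P? : Decidable P) {f : A → ℕ} {e} →
  (∀ x → P x → e ≤ f x) → ∀ xs → length (filter P? xs) * e ≤ sum (map f xs)
length-filter-≤-sum P? p [] = z≤n
length-filter-≤-sum P? {f} p (x ∷ xs) with P? x
... | yes px = +-mono-≤ (p x px) (length-filter-≤-sum P? p xs)
... | no  _  = m≤n⇒m≤o+n (f x) (length-filter-≤-sum P? p xs)

length-allFin : ∀ n → length (allFin n) ≡ n
length-allFin n = length-tabulate {n = n} (λ i → i)

-- Sampling vertices and selecting an edge per surviving colour.

module Selection {n k : ℕ} (G : TwoMatchingColoredGraph n k) where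
  open TwoMatchingColoredGraph G

  record DenseSelection (P Q : ℕ) : Set where
    field
      slot   : Fin k → Fin 2
      ws     : List (Fin n)
      hs     : List (Fin k)
      unique : Unique hs
      inside : ∀ {c} → c ∈ hs → proj₁ (edge c (slot c)) ∈ ws × proj₂ (edge c (slot c)) ∈ ws
      dense  : P * length ws < Q * length hs

  -- Keeping every vertex independently with probability a / b makes colour c
  -- survive with probability 2 (a/b)² - (a/b)⁴, as its two edges are disjoint.
  -- The polynomials H and F compare the expected number of surviving colours
  -- (weight Q) with that of kept vertices (weight P), cleared of denominators
  -- and of subtractions; rounding derandomises the choice.
  module _ (a d P Q : ℕ) .{{_ : NonZero (d + a)}} where
    open Rounding {n} a d

    first second : Fin k → Edge n
    first  c = edge c fzero
    second c = edge c (fsuc fzero)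

    pair : Edge n → List (Fin n)
    pair e = proj₁ e ∷ proj₂ e ∷ []

    quadruple : Fin k → List (Fin n)
    quadruple c = proj₁ (first c) ∷ proj₂ (first c) ∷ pair (second c)

    pairs : Fin k → Point → ℕ
    pairs c x = monomial (pair (first c)) x + monomial (pair (second c)) x

    -- The common denominator is b⁴: pairs have degree 2, quadruples 4 and single vertices 1, hence
    -- the factors b² and b³.
    H F : Point → ℕ
    H x = Q * (b * b * sum (map (λ c → pairs c x) (allFin k)))
    F x = Q * sum (map (λ c → monomial (quadruple c) x) (allFin k))
        + P * (b * b * b) * sum (map (λ v → monomial (v ∷ []) x) (allFin n))

    pair-unique : ∀ c i → Unique (pair (edge c i))
    pair-unique c i = (loopless c i ∷ []) ∷ [] ∷ []

    -- The matching condition enters here, making the quadruple monomial affine in each coordinate.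
    quadruple-unique : ∀ c → Unique (quadruple c)
    quadruple-unique c =
      (loopless c fzero
        ∷ (λ eq → matching c _ (inj₁ refl) (inj₁ eq))
        ∷ (λ eq → matching c _ (inj₁ refl) (inj₂ eq)) ∷ [])
      ∷ ((λ eq → matching c _ (inj₂ refl) (inj₁ eq))
        ∷ (λ eq → matching c _ (inj₂ refl) (inj₂ eq)) ∷ [])
      ∷ pair-unique c (fsuc fzero)

    H-affine : Affine H
    H-affine = affine-* Q (affine-* (b * b) (affine-sum pairs (λ c →
      affine-+ (affine-monomial (pair-unique c fzero)) (affine-monomial (pair-unique c (fsuc fzero)))) (allFin k)))

    F-affine : Affine F
    F-affine = affine-+
      (affine-* Q (affine-sum (monomial ∘ quadruple) (λ c → affine-monomial (quadruple-unique c)) (allFin k)))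
      (affine-* (P * (b * b * b)) (affine-sum (λ v → monomial (v ∷ [])) (λ v → affine-monomial ([] ∷ [])) (allFin n)))

    module _ (y : Point) (rounded : Rounded y) (F<H : F y < H y) where
      Full : Edge n → Set
      Full e = y (proj₁ e) ≡ b × y (proj₂ e) ≡ b

      full? : Decidable Full
      full? e = (y (proj₁ e) ≟ b) ×-dec (y (proj₂ e) ≟ b)

      ¬full⇒0 : ∀ e → ¬ Full e → monomial (pair e) y ≡ 0
      ¬full⇒0 (u , v) ¬f with rounded u | rounded v
      ... | inj₁ u0 | _       = cong (_* (y v * 1)) u0
      ... | inj₂ _  | inj₁ v0 = trans (cong (λ z → y u * (z * 1)) v0) (*-zeroʳ (y u))
      ... | inj₂ ub | inj₂ vb = contradiction (ub , vb) ¬f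

      firstOrSecond : ∀ {A : Set} → Dec A → Fin 2
      firstOrSecond (yes _) = fzero
      firstOrSecond (no _)  = fsuc fzero

      -- The second edge is the default even when neither is kept; `Survives` then fails, so it
      -- holds exactly for colours with a kept edge.
      chosen : Fin k → Fin 2
      chosen c = firstOrSecond (full? (first c))

      Survives : Fin k → Set
      Survives c = Full (edge c (chosen c))

      survives? : Decidable Survives
      survives? c = full? (edge c (chosen c))

      -- Inclusion-exclusion at a rounded point, where a kept edge has monomial b² and any other
      -- edge 0.
      survivor-bound : ∀ c → Survives c →
        b * b * pairs c y ≤ monomial (quadruple c) y + b * b * b * b
      survivor-bound c f with full? (first c)
      ... | yes (ub , vb) rewrite ub | vb = ≤-reflexive (regroup b _)
        where
        regroup : ∀ b m → b * b * (b * (b * 1) + m) ≡ b * (b * m) + b * b * b * b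
        regroup = solve-∀
      ... | no ¬f rewrite ¬full⇒0 (first c) ¬f | proj₁ f | proj₂ f =
        ≤-trans (≤-reflexive (regroup b)) (m≤n+m _ _)
        where
        regroup : ∀ b → b * b * (b * (b * 1)) ≡ b * b * b * b
        regroup = solve-∀

      casualty-bound : ∀ c → ¬ Survives c → b * b * pairs c y ≤ monomial (quadruple c) y
      casualty-bound c ¬s with full? (first c)
      ... | yes f = contradiction f ¬s
      ... | no ¬f rewrite ¬full⇒0 (first c) ¬f | ¬full⇒0 (second c) ¬s | *-zeroʳ (b * b) = z≤n

      selection : DenseSelection P Q
      selection = record
        { slot   = chosen
        ; ws     = W
        ; hs     = S
        ; unique = filter⁺ survives? (allFin⁺ k)
        ; inside = λ {c} c∈ → let f = proj₂ (∈-filter⁻ survives? {xs = allFin k} c∈) in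
                   ∈-filter⁺ kept? (∈-allFin _) (proj₁ f) , ∈-filter⁺ kept? (∈-allFin _) (proj₂ f)
        -- The survivor and casualty bounds turn `H y` into a count of survivors, and each kept
        -- vertex contributes `b` to `F y`; cancelling `quads` and b⁴ leaves the density.
        ; dense  = *-cancelʳ-< _ _ _ (+-cancelˡ-< (Q * quads) _ _ (begin-strict
            Q * quads + P * length W * (b * b * b * b)
              ≡⟨ regroup (Q * quads) P (length W) b ⟩
            Q * quads + P * (b * b * b) * (length W * b)
              ≤⟨ +-monoʳ-≤ (Q * quads) (*-monoʳ-≤ (P * (b * b * b)) kept≤) ⟩
            F y
              <⟨ F<H ⟩
            H y
              ≡⟨ cong (Q *_) (sum-map-*ˡ (b * b) (λ c → pairs c y) (allFin k)) ⟩
            Q * sum (map (λ c → b * b * pairs c y) (allFin k))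
              ≤⟨ *-monoʳ-≤ Q (sum-map-≤-filter survives? survivor-bound casualty-bound (allFin k)) ⟩
            Q * (quads + length S * (b * b * b * b))
              ≡⟨ trans (*-distribˡ-+ Q _ _) (cong (Q * quads +_) (sym (*-assoc Q _ _))) ⟩
            Q * quads + Q * length S * (b * b * b * b) ∎))
        }
        where
        open ≤-Reasoning
        kept? : Decidable (λ v → y v ≡ b)
        kept? v = y v ≟ b
        W = filter kept? (allFin n)
        S = filter survives? (allFin k)
        quads = sum (map (λ c → monomial (quadruple c) y) (allFin k))
        regroup : ∀ s p w b → s + p * w * (b * b * b * b) ≡ s + p * (b * b * b) * (w * b)
        regroup = solve-∀
        sum-cong : ∀ vs → sum (map (λ v → monomial (v ∷ []) y) vs) ≡ sum (map y vs)
        sum-cong []       = refl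
        sum-cong (v ∷ vs) = cong₂ _+_ (*-identityʳ (y v)) (sum-cong vs)
        kept≤ : length W * b ≤ sum (map (λ v → monomial (v ∷ []) y) (allFin n))
        kept≤ = ≤-trans (length-filter-≤-sum kept? (λ _ → ≤-reflexive ∘ sym) (allFin n)) (≤-reflexive (sym (sum-cong (allFin n))))

    -- The hypothesis is `F < H` at the constant point `a`, where every vertex is undecided: the
    -- inequality between expectations.
    denseSelection : P * (b * b * b) * (n * a) + Q * (k * (a * a * a * a)) < Q * (b * b * (k * (2 * (a * a)))) →
                     DenseSelection P Q
    denseSelection lt =
      let y , r , F<H = round F-affine H-affine (allFin n) (const a) (λ v → inj₂ (refl , ∈-allFin v)) F<H-mean
      in selection y r F<H
      where
      open ≤-Reasoning
      quart : ∀ a → a * (a * (a * (a * 1))) ≡ a * a * a * a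
      quart = solve-∀
      square : ∀ a → a * (a * 1) + a * (a * 1) ≡ 2 * (a * a)
      square = solve-∀
      F<H-mean : F (const a) < H (const a)
      F<H-mean = begin-strict
        F (const a)
          ≡⟨ cong₂ (λ s t → Q * s + P * (b * b * b) * t)
               (sum-map-const {f = λ c → monomial (quadruple c) (const a)} (λ c → quart a) (allFin k))
               (sum-map-const {f = λ v → monomial (v ∷ []) (const a)} (λ v → *-identityʳ a) (allFin n)) ⟩
        Q * (length (allFin k) * (a * a * a * a)) + P * (b * b * b) * (length (allFin n) * a)
          ≡⟨ cong₂ (λ s t → Q * (s * (a * a * a * a)) + P * (b * b * b) * (t * a)) (length-allFin k) (length-allFin n) ⟩
        Q * (k * (a * a * a * a)) + P * (b * b * b) * (n * a)
          ≡⟨ +-comm _ (P * (b * b * b) * (n * a)) ⟩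
        P * (b * b * b) * (n * a) + Q * (k * (a * a * a * a))
          <⟨ lt ⟩
        Q * (b * b * (k * (2 * (a * a))))
          ≡⟨ cong (λ s → Q * (b * b * (s * (2 * (a * a))))) (length-allFin k) ⟨
        Q * (b * b * (length (allFin k) * (2 * (a * a))))
          ≡⟨ cong (λ s → Q * (b * b * s))
               (sum-map-const {f = λ c → pairs c (const a)} (λ c → square a) (allFin k)) ⟨
        H (const a) ∎

-- A rational density close to √(2/3).

sqrt-third : ∀ M → Σ ℕ λ a → 3 * (a * a) ≤ M × M < 3 * (suc a * suc a)
sqrt-third zero = 0 , z≤n , s≤s z≤n
sqrt-third (suc M) with a , lo , hi ← sqrt-third M with 3 * (suc a * suc a) ≤? suc M
... | yes le = suc a , le , ≤-<-trans hi (*-monoʳ-< 3 (*-mono-< (n<1+n (suc a)) (n<1+n (suc a))))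
... | no  gt = a , m≤n⇒m≤1+n lo , ≰⇒> gt

square-cancel-< : ∀ {x y} → x * x < y * y → x < y
square-cancel-< lt = ≰⇒> λ y≤x → <⇒≱ lt (*-mono-≤ y≤x y≤x)

square-cancel-≤ : ∀ {x y} → x * x ≤ y * y → x ≤ y
square-cancel-≤ le = ≮⇒≥ λ y<x → <⇒≱ (*-mono-< y<x y<x) le

-- The maximum of 2x - x³ is attained at x = √(2/3) with squared value 32/27,
-- quantitatively 27 y (2 - y)² + (3y - 2)² (8 - 3y) = 32 for y = x².
-- A rational a/b close enough to √(2/3) therefore does as well as needed.
goodDensity : ∀ p q → 27 * (q * q) < 32 * (p * p) →
  Σ ℕ λ a → Σ ℕ λ d → 1 ≤ a × 1 ≤ d + a ×
  q * ((d + a) * (d + a) * (d + a)) + p * (a * a * a) < 2 * (p * (a * ((d + a) * (d + a))))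
goodDensity zero q ()
goodDensity p@(suc p-1) q gap = a , β ∸ a , 1≤a , subst (1 ≤_) (sym d+a) 1≤β ,
  subst (λ b → q * (b * b * b) + p * (a * a * a) < 2 * (p * (a * (b * b)))) (sym d+a) Y+<
  where
  open ≤-Reasoning
  β B : ℕ
  -- The factor is chosen so that its square 729 exceeds the 648 in the error bound E ≤ 648p²B²,
  -- while B³ = 729p²B².
  β = 27 * p
  B = β * β
  1≤β : 1 ≤ β
  1≤β = s≤s z≤n
  -- The largest `a` with a/β ≤ √(2/3); maximality keeps the shortfall `t` of order β.
  a = proj₁ (sqrt-third (2 * B))
  A = a * a
  lo = proj₁ (proj₂ (sqrt-third (2 * B)))
  hi = proj₂ (proj₂ (sqrt-third (2 * B)))
  t s X Y E : ℕ
  t = 2 * B ∸ 3 * A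
  3A+t : 3 * A + t ≡ 2 * B
  3A+t = m+[n∸m]≡n lo
  -- As 3A + t = 2B, `s` is 2B - A. With x = a/β, `X` is pβ³(2x - x³), to be compared with `Y` =
  -- qβ³; `E` is p²B³ times the error term of the identity at y = A/B.
  s = 2 * A + t
  X = p * a * s
  Y = q * (β * β * β)
  E = p * p * (t * t) * (6 * B + t)
  a≤β : a ≤ β
  a≤β = square-cancel-≤ (*-cancelˡ-≤ 3 (≤-trans lo (*-monoˡ-≤ B (s≤s (s≤s (z≤n {1}))))))
  d+a : β ∸ a + a ≡ β
  d+a = m∸n+n≡m a≤β
  t≤9β : t ≤ 9 * β
  t≤9β = +-cancelˡ-≤ (3 * A) _ _ (begin
    3 * A + t                     ≡⟨ 3A+t ⟩
    2 * B                         ≤⟨ <⇒≤ hi ⟩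
    3 * (suc a * suc a)           ≡⟨ expandSquare a ⟩
    3 * A + (6 * a + 3 * 1)       ≤⟨ +-monoʳ-≤ (3 * A) (+-mono-≤ (*-monoʳ-≤ 6 a≤β) (*-monoʳ-≤ 3 1≤β)) ⟩
    3 * A + (6 * β + 3 * β)       ≡⟨ cong (3 * A +_) (sym (*-distribʳ-+ β 6 3)) ⟩
    3 * A + 9 * β                 ∎)
    where
    expandSquare : ∀ a → 3 * (suc a * suc a) ≡ 3 * (a * a) + (6 * a + 3 * 1)
    expandSquare = solve-∀
  t≤2B : t ≤ 2 * B
  t≤2B = m∸n≤m (2 * B) (3 * A)
  E<B³ : E < B * B * B
  E<B³ = begin-strict
    p * p * (t * t) * (6 * B + t)             ≤⟨ *-mono-≤ (*-monoʳ-≤ (p * p) (*-mono-≤ t≤9β t≤9β)) (+-monoʳ-≤ (6 * B) t≤2B) ⟩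
    p * p * (9 * β * (9 * β)) * (6 * B + 2 * B) ≡⟨ collect p β ⟩
    648 * (p * p) * (B * B)                   <⟨ *-monoˡ-< (B * B) (*-monoˡ-< (p * p) (m≤m+n 649 80)) ⟩
    729 * (p * p) * (B * B)                   ≡⟨ collect′ p B ⟩
    B * B * B                                 ∎
    where
    collect : ∀ p β → p * p * (9 * β * (9 * β)) * (6 * (β * β) + 2 * (β * β)) ≡ 648 * (p * p) * (β * β * (β * β))
    collect = solve-∀
    collect′ : ∀ p B → 729 * (p * p) * (B * B) ≡ 27 * p * (27 * p) * B * B
    collect′ = solve-∀
  -- The identity at y = A/B, multiplied by 8p²B³; writing 2B as 3A + t makes it polynomial in `p`,
  -- `a` and `t`.
  cubic : 216 * (X * X) + 8 * E ≡ 32 * (p * p) * (2 * B * (2 * B * (2 * B)))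
  cubic = trans (cong (λ z → 216 * (X * X) + 8 * (p * p * (t * t) * (z + t))) (sixB B))
    (trans (cong (λ z → 216 * (X * X) + 8 * (p * p * (t * t) * (3 * z + t))) (sym 3A+t))
    (trans (identity p a t) (cong (λ z → 32 * (p * p) * (z * (z * z))) 3A+t)))
    where
    sixB : ∀ B → 6 * B ≡ 3 * (2 * B)
    sixB = solve-∀
    identity : ∀ p a t →
      216 * (p * a * (2 * (a * a) + t) * (p * a * (2 * (a * a) + t))) + 8 * (p * p * (t * t) * (3 * (3 * (a * a) + t) + t))
      ≡ 32 * (p * p) * ((3 * (a * a) + t) * ((3 * (a * a) + t) * (3 * (a * a) + t)))
    identity = solve-∀
  Y<X : Y < X
  -- By integrality the gap gives 27q² + 1 ≤ 32p²; after scaling by 8B³ the extra 1 pays for 8E.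
  Y<X = square-cancel-< (*-cancelˡ-< 216 _ _ (+-cancelʳ-< (8 * E) _ _ (begin-strict
    216 * (Y * Y) + 8 * E                       <⟨ +-monoʳ-< (216 * (Y * Y)) (*-monoʳ-< 8 E<B³) ⟩
    216 * (Y * Y) + 8 * (B * B * B)             ≡⟨ collect q β ⟩
    suc (27 * (q * q)) * (2 * B * (2 * B * (2 * B))) ≤⟨ *-monoˡ-≤ (2 * B * (2 * B * (2 * B))) gap ⟩
    32 * (p * p) * (2 * B * (2 * B * (2 * B)))  ≡⟨ cubic ⟨
    216 * (X * X) + 8 * E                       ∎)))
    where
    collect : ∀ q β → 216 * (q * (β * β * β) * (q * (β * β * β))) + 8 * (β * β * (β * β) * (β * β))
      ≡ suc (27 * (q * q)) * (2 * (β * β) * (2 * (β * β) * (2 * (β * β))))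
    collect = solve-∀
  1≤a : 1 ≤ a
  1≤a = n≢0⇒n>0 λ a≡0 → n≮0 (subst (Y <_) (trans (cong (λ z → p * z * s) a≡0) (cong (_* s) (*-zeroʳ p))) Y<X)
  Y+< : q * (β * β * β) + p * (a * a * a) < 2 * (p * (a * (β * β)))
  Y+< = begin-strict
    Y + p * (a * a * a)              <⟨ +-monoˡ-< (p * (a * a * a)) Y<X ⟩
    X + p * (a * a * a)              ≡⟨ collect p a t ⟩
    p * a * (3 * A + t)              ≡⟨ cong (p * a *_) 3A+t ⟩
    p * a * (2 * B)                  ≡⟨ collect′ p a B ⟩
    2 * (p * (a * (β * β)))          ∎
    where
    collect : ∀ p a t → p * a * (2 * (a * a) + t) + p * (a * a * a) ≡ p * a * (3 * (a * a) + t)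
    collect = solve-∀
    collect′ : ∀ p a B → p * a * (2 * B) ≡ 2 * (p * (a * B))
    collect′ = solve-∀

-- Exponential growth and logarithmic bounds.

bernoulli : ∀ Q m → Q ^ m * (Q + m) ≤ Q * suc Q ^ m
bernoulli Q zero = ≤-reflexive (trans (+-identityʳ (Q + 0)) (trans (+-identityʳ Q) (sym (*-identityʳ Q))))
bernoulli Q (suc m) = begin
  Q * Q ^ m * (Q + suc m)              ≤⟨ m≤m+n _ (Q ^ m * m) ⟩
  Q * Q ^ m * (Q + suc m) + Q ^ m * m  ≡⟨ collect Q (Q ^ m) m ⟩
  suc Q * (Q ^ m * (Q + m))            ≤⟨ *-monoʳ-≤ (suc Q) (bernoulli Q m) ⟩
  suc Q * (Q * suc Q ^ m)              ≡⟨ swap Q (suc Q ^ m) ⟩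
  Q * (suc Q * suc Q ^ m)              ∎
  where
  open ≤-Reasoning
  collect : ∀ Q e m → Q * e * (Q + suc m) + e * m ≡ suc Q * (e * (Q + m))
  collect = solve-∀
  swap : ∀ Q e → suc Q * (Q * e) ≡ Q * (suc Q * e)
  swap = solve-∀

-- Bernoulli's (1 + 1/Q)^m ≥ 1 + m/Q at m = Q: growth by the factor 1 + 1/Q doubles within `Q`
-- rounds.
2Q^Q≤[1+Q]^Q : ∀ Q → .{{_ : NonZero Q}} → 2 * Q ^ Q ≤ suc Q ^ Q
2Q^Q≤[1+Q]^Q Q = *-cancelˡ-≤ Q (≤-trans (≤-reflexive (collect Q (Q ^ Q))) (bernoulli Q Q))
  where
  collect : ∀ Q e → Q * (2 * e) ≡ e * (Q + Q)
  collect = solve-∀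

log-ceil : ∀ n → 1 ≤ n → Σ ℕ λ s → n < 2 ^ s × 2 ^ s ≤ 2 * n
log-ceil (suc zero) _ = 1 , s≤s (s≤s z≤n) , ≤-refl
log-ceil (suc n@(suc _)) _ with s , lo , hi ← log-ceil n (s≤s z≤n) with 2 ^ s ≤? suc n
... | yes le = suc s , ≤-<-trans lo (^-monoʳ-< 2 (s≤s (s≤s z≤n)) (n<1+n s)) , *-monoʳ-≤ 2 le
... | no gt = s , ≰⇒> gt , ≤-trans hi (*-monoʳ-≤ 2 (n≤1+n n))

-- After multiplying by `q`, replacing `k * q` by `p * n` and dividing by `n * a`, the claim is Y +
-- Q(Y + pa³) < 2Qpab² with Y = qb³. By integrality `good` has slack 1, worth `Q` after scaling, and
-- Q = Y + 1 exceeds the extra `Y`. So ε = 1/Q.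
selection-inequality : ∀ p q n k a b → .{{NonZero q}} → 1 ≤ n → 1 ≤ a → k * q ≡ p * n →
  q * (b * b * b) + p * (a * a * a) < 2 * (p * (a * (b * b))) →
  let Q = suc (q * (b * b * b)) in
  suc Q * (b * b * b) * (n * a) + Q * (k * (a * a * a * a)) < Q * (b * b * (k * (2 * (a * a))))
selection-inequality p q n k a b 1≤n 1≤a kq≡pn good = *-cancelˡ-< q _ _ (begin-strict
  q * (suc Q * (b * b * b) * (n * a) + Q * (k * (a * a * a * a)))
    ≡⟨ collect q Q k n a b ⟩
  n * a * (suc Q * Y) + Q * (k * q) * (a * a * a * a)
    ≡⟨ cong (λ z → n * a * (suc Q * Y) + Q * z * (a * a * a * a)) kq≡pn ⟩
  n * a * (suc Q * Y) + Q * (p * n) * (a * a * a * a)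
    ≡⟨ collect′ p Y Q n a ⟩
  n * a * (Y + Q * (Y + p * (a * a * a)))
    <⟨ *-monoʳ-< (n * a) {{>-nonZero (*-mono-≤ 1≤n 1≤a)}} (+-monoˡ-< (Q * (Y + p * (a * a * a))) (n<1+n Y)) ⟩
  n * a * (Q + Q * (Y + p * (a * a * a)))
    ≡⟨ cong (n * a *_) (*-suc Q _) ⟨
  n * a * (Q * suc (Y + p * (a * a * a)))
    ≤⟨ *-monoʳ-≤ (n * a) (*-monoʳ-≤ Q good) ⟩
  n * a * (Q * (2 * (p * (a * (b * b)))))
    ≡⟨ collect″ p Q n a b ⟩
  Q * (b * b * (p * n * (2 * (a * a))))
    ≡⟨ cong (λ z → Q * (b * b * (z * (2 * (a * a))))) kq≡pn ⟨
  Q * (b * b * (k * q * (2 * (a * a))))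
    ≡⟨ collect‴ q Q k a b ⟩
  q * (Q * (b * b * (k * (2 * (a * a))))) ∎)
  where
  open ≤-Reasoning
  Y Q : ℕ
  Y = q * (b * b * b)
  Q = suc Y
  collect : ∀ q Q k n a b → q * (suc Q * (b * b * b) * (n * a) + Q * (k * (a * a * a * a)))
    ≡ n * a * (suc Q * (q * (b * b * b))) + Q * (k * q) * (a * a * a * a)
  collect = solve-∀
  collect′ : ∀ p Y Q n a → n * a * (suc Q * Y) + Q * (p * n) * (a * a * a * a)
    ≡ n * a * (Y + Q * (Y + p * (a * a * a)))
  collect′ = solve-∀
  collect″ : ∀ p Q n a b → n * a * (Q * (2 * (p * (a * (b * b))))) ≡ Q * (b * b * (p * n * (2 * (a * a))))
  collect″ = solve-∀
  collect‴ : ∀ q Q k a b → Q * (b * b * (k * q * (2 * (a * a)))) ≡ q * (Q * (b * b * (k * (2 * (a * a)))))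
  collect‴ = solve-∀

^-distribʳ-* : ∀ m n o → (m * n) ^ o ≡ m ^ o * n ^ o
^-distribʳ-* m n zero    = refl
^-distribʳ-* m n (suc o) = trans (cong (m * n *_) (^-distribʳ-* m n o)) (regroup m n (m ^ o) (n ^ o))
  where
  regroup : ∀ m n x y → m * n * (x * y) ≡ m * x * (n * y)
  regroup = solve-∀

-- The `Q * s` rounds form `s` blocks, each at least doubling the ball.
growth-beats : ∀ Q s n → .{{NonZero Q}} → n < 2 ^ s → Q ^ (Q * s) * n < suc Q ^ (Q * s)
growth-beats Q s n n<2^s = begin-strict
  Q ^ (Q * s) * n       <⟨ *-monoʳ-< (Q ^ (Q * s)) {{m^n≢0 Q (Q * s)}} n<2^s ⟩
  Q ^ (Q * s) * 2 ^ s   ≡⟨ cong (_* 2 ^ s) (^-*-assoc Q Q s) ⟨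
  (Q ^ Q) ^ s * 2 ^ s   ≡⟨ *-comm ((Q ^ Q) ^ s) (2 ^ s) ⟩
  2 ^ s * (Q ^ Q) ^ s   ≡⟨ ^-distribʳ-* 2 (Q ^ Q) s ⟨
  (2 * Q ^ Q) ^ s       ≤⟨ ^-monoˡ-≤ s (2Q^Q≤[1+Q]^Q Q) ⟩
  (suc Q ^ Q) ^ s       ≡⟨ ^-*-assoc (suc Q) Q s ⟩
  suc Q ^ (Q * s)       ∎
  where open ≤-Reasoning

-- One factor `n` absorbs the 2 of the last edge, and 2^s ≤ 2n ≤ n² handles the rest.
length-logarithmic : ∀ Q s n m → 2 ≤ n → 2 ^ s ≤ 2 * n → m ≤ Q * s + Q * s →
  2 ^ suc m ≤ n ^ suc (4 * Q)
length-logarithmic Q s n m 2≤n 2^s≤2n m≤ = *-mono-≤ 2≤n (begin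
  2 ^ m                   ≤⟨ ^-monoʳ-≤ 2 m≤ ⟩
  2 ^ (Q * s + Q * s)     ≡⟨ cong (2 ^_) (collect Q s) ⟩
  2 ^ (s * (2 * Q))       ≡⟨ ^-*-assoc 2 s (2 * Q) ⟨
  (2 ^ s) ^ (2 * Q)       ≤⟨ ^-monoˡ-≤ (2 * Q) (≤-trans 2^s≤2n (*-mono-≤ 2≤n (≤-reflexive (sym (*-identityʳ n))))) ⟩
  (n ^ 2) ^ (2 * Q)       ≡⟨ ^-*-assoc n 2 (2 * Q) ⟩
  n ^ (2 * (2 * Q))       ≡⟨ cong (n ^_) (*-assoc 2 2 Q) ⟨
  n ^ (4 * Q)             ∎)
  where
  open ≤-Reasoning
  collect : ∀ Q s → Q * s + Q * s ≡ s * (2 * Q)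
  collect = solve-∀

-- Assembling sampling and growth.

dense⇒cycle : ∀ {n k} (G : TwoMatchingColoredGraph n k) Q → .{{NonZero Q}} → 1 ≤ n →
  Selection.DenseSelection G (suc Q) Q → Σ ℕ λ m → (2 ^ suc m ≤ n ^ suc (4 * Q)) × RainbowCycle G m
dense⇒cycle {n} G Q 1≤n D =
  let s , n<2^s , 2^s≤2n = log-ceil n 1≤n
      m , m≤ , C = Growth.shortCycle G slot Q (suc Q) (Q * s) (growth-beats Q s n n<2^s)
                     (length ws) ws hs ≤-refl unique inside dense
      -- The cycle found has at least three distinct vertices.
      2≤n = ≤-trans (RainbowCycle.long C) (≤-trans (n≤1+n m) (injective⇒≤ (RainbowCycle.vtx-inj C)))
  in m , length-logarithmic Q s n m 2≤n 2^s≤2n m≤ , C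
  where open Selection.DenseSelection D

-- Here α = p/q, and since (3√6/8)² = 27/32 the hypothesis says α > 3√6/8. The conclusion
-- `2 ^ suc m ≤ n ^ C` says that the `m + 1` edges number at most C log n.
theorem6 : (p q : ℕ) → .{{_ : NonZero q}} → 27 * (q * q) < 32 * (p * p) →
    Σ ℕ λ C → (n k : ℕ) → 1 ≤ n → k * q ≡ p * n →
    (G : TwoMatchingColoredGraph n k) →
    Σ ℕ λ m → (2 ^ suc m ≤ n ^ C) × RainbowCycle G m
theorem6 p q gap =
  let a , d , 1≤a , 1≤b , good = goodDensity p q gap
      b = d + a
      Q = suc (q * (b * b * b))
  in suc (4 * Q) , λ n k 1≤n kq≡pn G → dense⇒cycle G Q 1≤n
       (Selection.denseSelection G a d (suc Q) Q {{>-nonZero 1≤b}}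
         (selection-inequality p q n k a b 1≤n 1≤a kq≡pn good))
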